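{- Let $k\ge2$ and let $\mathcal{G}$ and $\mathcal{F}$ be $k$-uniform hypergraphs such that $\mathcal{G}$ contains a copy of $H_3^{(k)}$. If there is a homomorphism from $\mathcal{G}$ to $\mathcal{F}$, then $ex_{\mathcal{F}}(n,\mathcal{G})=n^{k-o(1)}$. In particular, $ex_{K_t^{(k)}}(n,K_r^{(k)})=n^{k-o(1)}$ whenever $t\ge r>k$.
   Context: For $k$-uniform hypergraphs $\mathcal{F}$ and $\mathcal{G}$, consider $n$-vertex $k$-uniform hypergraphs $\mathcal{R}$ whose edge set is the union of pairwise edge-disjoint subhypergraphs each isomorphic to $\mathcal{F}$ (called $\mathcal{F}$-copies; each is thought of as a single colour). A subhypergraph of $\mathcal{R}$ is rainbow if its edges come from pairwise distinct $\mathcal{F}$-copies. $ex_{\mathcal{F}}(n,\mathcal{G})$ is the maximum number of $\mathcal{F}$-copies in such an $n$-vertex $\mathcal{R}$ with no rainbow copy of $\mathcal{G}$. $H_3^{(k)}$ (the $k$-uniform tight triangle) is the unique (up to isomorphism) $k$-uniform hypergraph on $k+1$ vertices with exactly $3$ edges. $K_t^{(k)}$ is the complete $k$-uniform hypergraph on $t$ vertices. A homomorphism from $\mathcal{G}$ to $\mathcal{F}$ is a map $\varphi:V(\mathcal{G})\to V(\mathcal{F})$ with $\varphi(e)\in E(\mathcal{F})$ for every $e\in E(\mathcal{G})$. The notation $f(n)=n^{k-o(1)}$ means $f(n)=n^{k-g(n)}$ for some function $g(n)\to0$ as $n\to\infty$. -}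

module Defs where

open import Data.Nat using (ℕ; zero; suc; _+_; _*_; _∸_; _^_; _≤_; _<_)
open import Data.Bool using (Bool; true; false; _∧_)
open import Data.Fin using (Fin; zero; suc; _≟_)
open import Data.Fin.Subset using (Subset; ∣_∣; ⁅_⁆; ∁)
open import Data.Fin.Properties using (any?)
open import Data.Vec using (lookup; tabulate)
open import Data.Product using (Σ; ∃; ∃-syntax; _×_; _,_)
open import Data.Sum using (_⊎_)
open import Relation.Binary.PropositionalEquality using (_≡_; _≢_)
open import Relation.Nullary using (¬_)
open import Relation.Nullary.Decidable using (⌊_⌋)
open import Function.Definitions using (Injective)

record Hypergraph : Set₁ where
  field
    V     : ℕ
    Edge  : Subset V → Set
open Hypergraph public

Uniform : ℕ → Hypergraph → Set
Uniform k H = ∀ e → Edge H e → ∣ e ∣ ≡ k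

image : {a b : ℕ} → (Fin a → Fin b) → Subset a → Subset b
image {a} φ p = tabulate λ j → ⌊ any? {n = a} (λ i → Data.Bool._≟_ (lookup p i ∧ ⌊ φ i ≟ j ⌋) true) ⌋

Hom : Hypergraph → Hypergraph → Set
Hom G F = Σ (Fin (V G) → Fin (V F)) λ φ → ∀ e → Edge G e → Edge F (image φ e)

ContainsCopy : (H G : Hypergraph) → Set
ContainsCopy H G = Σ (Fin (V G) → Fin (V H)) λ ψ →
  Injective _≡_ _≡_ ψ × (∀ e → Edge G e → Edge H (image ψ e))

-- The k-uniform tight triangle H_3^{(k)} for k = 2 + k': vertex set Fin (k+1),
-- edges: the complements of the single vertices 0, 1, 2 (three k-sets on k+1 vertices).
H3 : ℕ → Hypergraph
H3 k' = record
  { V    = 3 + k'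
  ; Edge = λ e → (e ≡ ∁ ⁅ zero ⁆) ⊎ (e ≡ ∁ ⁅ suc zero ⁆) ⊎ (e ≡ ∁ ⁅ suc (suc zero) ⁆) }

K : ℕ → ℕ → Hypergraph
K k t = record { V = t ; Edge = λ e → ∣ e ∣ ≡ k }

CopyEdge : {n : ℕ} (F : Hypergraph) → (Fin (V F) → Fin n) → Subset n → Set
CopyEdge F ψ e = ∃[ f ] (Edge F f × image ψ f ≡ e)

record Packing (F : Hypergraph) (n : ℕ) : Set₁ where
  field
    m        : ℕ
    copy     : Fin m → Fin (V F) → Fin n
    copyInj  : ∀ c → Injective _≡_ _≡_ (copy c)
    disjoint : ∀ c d → c ≢ d → ∀ e → CopyEdge F (copy c) e → ¬ CopyEdge F (copy d) e
open Packing public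

RainbowCopy : {F : Hypergraph} {n : ℕ} → Packing F n → Hypergraph → Set
RainbowCopy {F} {n} P G =
  Σ (Fin (V G) → Fin n) λ χ → Injective _≡_ _≡_ χ ×
  Σ ((e : Subset (V G)) → Edge G e → Fin (m P)) λ col →
    (∀ e (pe : Edge G e) → CopyEdge F (copy P (col e pe)) (image χ e)) ×
    (∀ e e′ (pe : Edge G e) (pe′ : Edge G e′) → col e pe ≡ col e′ pe′ → e ≡ e′)

ExAtLeast : Hypergraph → Hypergraph → ℕ → ℕ → Set₁
ExAtLeast F G n X = Σ (Packing F n) λ P → ¬ RainbowCopy P G × X ≤ m P

ExAtMost : Hypergraph → Hypergraph → ℕ → ℕ → Set₁
ExAtMost F G n Y = (P : Packing F n) → ¬ RainbowCopy P G → m P ≤ Y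

-- ex_F(n,G) = n^{k - o(1)}: for every ε = 1/(s+1), for all sufficiently large n,
--   n^{k-ε} ≤ ex_F(n,G) ≤ n^{k+ε},
-- written in integer form by raising to the power s+1.
ExIsNkMinusO1 : ℕ → Hypergraph → Hypergraph → Set₁
ExIsNkMinusO1 k F G = ∀ s → ∃[ N ] ∀ n → N ≤ n →
    (Σ ℕ λ X → ExAtLeast F G n X × n ^ (k * suc s ∸ 1) ≤ X ^ suc s)
  × (Σ ℕ λ Y → ExAtMost F G n Y × Y ^ suc s ≤ n ^ (k * suc s + 1))

{-# OPTIONS --safe #-}

-- Upper bound: edge-disjoint copies of F carry distinct copies of one fixed edge, so there are at
-- most nᵏ of them.
--
-- Lower bound: it suffices to avoid rainbow tight triangles. Colours are polynomials c of degree < k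
-- with values in ℤᴰ⁺¹, coefficients in a box, and the copy of F with colour c has the vertices
-- (j , c(j)) for j ∈ V(F). Polynomials sharing an edge agree in k positions, hence coincide. In a
-- rainbow tight triangle three polynomials agree pairwise in k − 1 positions with a common (k − 2)-set;
-- factoring their differences over these positions gives u(x₀ − x₁) = v(x₀ − x₂) for the leading
-- coefficients, where u, v, u − v ≠ 0. So x₀, x₁, x₂ are collinear, which forces x₀ = x₂ when the leading
-- coefficients are restricted to the paraboloid (x , |x|²). This restriction costs a factor d² when the
-- box has about dᴰ⁺² points, i.e. n^o(1) as D grows.
module Submission where

open import Defs
open import Data.Nat using (ℕ; _+_; _≤_; _<_)
open import Data.Product using (_×_)

open import Data.Bool using (true; _∧_)
import Data.Bool.Properties as Bool
open import Data.Fin as Fin using (Fin; zero; suc; toℕ; fromℕ<; inject≤; punchIn; combine; quotient; remainder; funToFin; finToFun)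
import Data.Fin.Properties as Fin
open import Data.Fin.Subset using (Subset; inside; outside; _∈_; _∉_; _⊆_; ∣_∣; ⁅_⁆; ∁)
import Data.Fin.Subset.Properties as Subset
open import Data.Integer as ℤ using (ℤ; +_; -[1+_]; 0ℤ)
  renaming (_+_ to _+ᶻ_; _*_ to _*ᶻ_; _-_ to _-ᶻ_)
import Data.Integer.Properties as ℤ
open import Data.Integer.Tactic.RingSolver using (solve-∀)
open import Data.Nat as ℕ using (zero; suc; _*_; _∸_; _^_; z≤n; s≤s; z<s)
import Data.Nat.Properties as ℕ
import Data.Nat.Tactic.RingSolver as ℕ
open import Data.Product using (∃; ∃-syntax; _,_; proj₁; proj₂)
open import Data.Sum using (inj₁; inj₂; [_,_]′)
open import Data.Vec using ([]; _∷_; here; there; lookup)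
open import Data.Vec.Properties using ([]=⇒lookup; lookup⇒[]=; lookup∘tabulate)
open import Function using (_∘_; Equivalence)
open import Function.Definitions using (Injective)
open import Relation.Binary.PropositionalEquality
open import Relation.Nullary using (¬_; Dec; yes; no; contradiction)
open import Relation.Nullary.Decidable using (⌊_⌋; toWitness; fromWitness)
open import Algebra.Properties.AbelianGroup ℤ.+-0-abelianGroup using () renaming (∙-cancelˡ to +ᶻ-cancelˡ)
open import Algebra.Properties.Monoid.Sum ℕ.+-0-monoid using () renaming (sum to ∑ℕ; sum-cong-≗ to ∑ℕ-cong)
open import Algebra.Properties.Monoid.Sum ℤ.+-0-monoid using () renaming (sum to ∑)
open import Algebra.Properties.Monoid.Sum ℤ.*-1-monoid using () renaming (sum to ∏)

private variable
  n : ℕ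

-- Polynomials over ℤ and their roots

-- The polynomial a₀ + a₁ x + ⋯ + aₙ₋₁ xⁿ⁻¹ + l xⁿ.
eval : (Fin n → ℤ) → ℤ → ℤ → ℤ
eval {zero}  a l x = l
eval {suc n} a l x = a zero +ᶻ x *ᶻ eval (a ∘ suc) l x

-- The lower coefficients of the quotient by x - r; its leading coefficient is again l.
quot : (Fin (suc n) → ℤ) → ℤ → ℤ → Fin n → ℤ
quot a l r zero    = eval (a ∘ suc) l r
quot a l r (suc i) = quot (a ∘ suc) l r i

-- Synthetic division: if the tail satisfies `p(x) = p(r) + (x - r) q(x)`, then the quotient of
-- `a₀ + x p(x)` is `p(r) + x q(x)`. Since `x - r` is monic, everything stays in ℤ.
eval-quot : (a : Fin (suc n) → ℤ) (l r x : ℤ) →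
  eval a l x ≡ eval a l r +ᶻ (x -ᶻ r) *ᶻ eval (quot a l r) l x
eval-quot {zero} a l r x = identity (a zero) l r x
  where
  identity : ∀ a₀ l r x → a₀ +ᶻ x *ᶻ l ≡ (a₀ +ᶻ r *ᶻ l) +ᶻ (x -ᶻ r) *ᶻ l
  identity = solve-∀
eval-quot {suc n} a l r x
  rewrite eval-quot (a ∘ suc) l r x
  = identity (a zero) (eval (a ∘ suc) l r) (eval (quot (a ∘ suc) l r) l x) r x
  where
  identity : ∀ a₀ p q r x →
    a₀ +ᶻ x *ᶻ (p +ᶻ (x -ᶻ r) *ᶻ q) ≡ (a₀ +ᶻ r *ᶻ p) +ᶻ (x -ᶻ r) *ᶻ (p +ᶻ x *ᶻ q)
  identity = solve-∀

eval-- : (a b : Fin n → ℤ) (l m x : ℤ) →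
  eval (λ i → a i -ᶻ b i) (l -ᶻ m) x ≡ eval a l x -ᶻ eval b m x
eval-- {zero}  a b l m x = refl
eval-- {suc n} a b l m x
  rewrite eval-- (a ∘ suc) (b ∘ suc) l m x
  = identity (a zero) (b zero) x (eval (a ∘ suc) l x) (eval (b ∘ suc) m x)
  where
  identity : ∀ a₀ b₀ x p q → (a₀ -ᶻ b₀) +ᶻ x *ᶻ (p -ᶻ q) ≡ (a₀ +ᶻ x *ᶻ p) -ᶻ (b₀ +ᶻ x *ᶻ q)
  identity = solve-∀

*≡0-cancelˡ : ∀ {i j} → i ≢ 0ℤ → i *ᶻ j ≡ 0ℤ → j ≡ 0ℤ
*≡0-cancelˡ {i} i≢0 ij≡0 = [ (λ i≡0 → contradiction i≡0 i≢0) , (λ j≡0 → j≡0) ]′ (ℤ.i*j≡0⇒i≡0∨j≡0 i ij≡0)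

-≢0 : ∀ {i j} → i ≢ j → i -ᶻ j ≢ 0ℤ
-≢0 i≢j = i≢j ∘ ℤ.i-j≡0⇒i≡j _ _

quot-root : (a : Fin (suc n) → ℤ) (l r s : ℤ) → r ≢ s →
  eval a l r ≡ 0ℤ → eval a l s ≡ 0ℤ → eval (quot a l r) l s ≡ 0ℤ
quot-root a l r s r≢s pr ps = *≡0-cancelˡ (-≢0 (r≢s ∘ sym)) (begin
  (s -ᶻ r) *ᶻ q                  ≡⟨ ℤ.+-identityˡ _ ⟨
  0ℤ +ᶻ (s -ᶻ r) *ᶻ q            ≡⟨ cong (_+ᶻ (s -ᶻ r) *ᶻ q) pr ⟨
  eval a l r +ᶻ (s -ᶻ r) *ᶻ q    ≡⟨ eval-quot a l r s ⟨
  eval a l s                     ≡⟨ ps ⟩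
  0ℤ                             ∎)
  where
  open ≡-Reasoning
  q = eval (quot a l r) l s

suc-injective : {A : Set} {r : Fin (suc n) → A} → Injective _≡_ _≡_ r → Injective _≡_ _≡_ (r ∘ suc)
suc-injective inj eq = Fin.suc-injective (inj eq)

-- Roots are split off one at a time; the quotient keeps `l` and the remaining roots. The leading
-- coefficient is formal and may be 0, so this applies to differences whose degree drops.
eval-factor : (a : Fin n → ℤ) (l : ℤ) (r : Fin n → ℤ) → Injective _≡_ _≡_ r →
  (∀ i → eval a l (r i) ≡ 0ℤ) → ∀ x → eval a l x ≡ l *ᶻ ∏ (λ i → x -ᶻ r i)
eval-factor {zero}  a l r inj root x = sym (ℤ.*-identityʳ l)
eval-factor {suc n} a l r inj root x = begin
  eval a l x                                              ≡⟨ eval-quot a l (r zero) x ⟩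
  eval a l (r zero) +ᶻ (x -ᶻ r zero) *ᶻ eval q l x        ≡⟨ cong (_+ᶻ (x -ᶻ r zero) *ᶻ eval q l x) (root zero) ⟩
  0ℤ +ᶻ (x -ᶻ r zero) *ᶻ eval q l x                       ≡⟨ cong (λ y → 0ℤ +ᶻ (x -ᶻ r zero) *ᶻ y) factored ⟩
  0ℤ +ᶻ (x -ᶻ r zero) *ᶻ (l *ᶻ ∏ (λ i → x -ᶻ r (suc i)))  ≡⟨ identity l (x -ᶻ r zero) _ ⟩
  l *ᶻ ∏ (λ i → x -ᶻ r i)                                 ∎
  where
  open ≡-Reasoning
  q = quot a l (r zero)
  factored : eval q l x ≡ l *ᶻ ∏ (λ i → x -ᶻ r (suc i))
  factored = eval-factor q l (r ∘ suc) (suc-injective inj)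
    (λ i → quot-root a l (r zero) (r (suc i)) (Fin.0≢1+n ∘ inj) (root zero) (root (suc i))) x
  identity : ∀ l y p → 0ℤ +ᶻ y *ᶻ (l *ᶻ p) ≡ l *ᶻ (y *ᶻ p)
  identity = solve-∀

∏≢0 : (f : Fin n → ℤ) → (∀ i → f i ≢ 0ℤ) → ∏ f ≢ 0ℤ
∏≢0 {zero}  f f≢0 ()
∏≢0 {suc n} f f≢0 = ∏≢0 (f ∘ suc) (f≢0 ∘ suc) ∘ *≡0-cancelˡ (f≢0 zero)

-- Undoing the synthetic division one coefficient at a time turns root counting into a statement
-- about coefficients.
quot≡0⇒≡0 : (a : Fin (suc n) → ℤ) (r : ℤ) → eval a 0ℤ r ≡ 0ℤ →
  (∀ i → quot a 0ℤ r i ≡ 0ℤ) → ∀ i → a i ≡ 0ℤ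
quot≡0⇒≡0 {zero} a r pr q≡0 zero = begin
  a zero              ≡⟨ identity (a zero) r ⟩
  a zero +ᶻ r *ᶻ 0ℤ   ≡⟨ pr ⟩
  0ℤ                  ∎
  where
  open ≡-Reasoning
  identity : ∀ a₀ r → a₀ ≡ a₀ +ᶻ r *ᶻ 0ℤ
  identity = solve-∀
quot≡0⇒≡0 {suc n} a r pr q≡0 (suc i) = quot≡0⇒≡0 (a ∘ suc) r (q≡0 zero) (q≡0 ∘ suc) i
quot≡0⇒≡0 {suc n} a r pr q≡0 zero = begin
  a zero                                 ≡⟨ identity (a zero) r ⟩
  a zero +ᶻ r *ᶻ 0ℤ                      ≡⟨ cong (λ y → a zero +ᶻ r *ᶻ y) (q≡0 zero) ⟨
  a zero +ᶻ r *ᶻ eval (a ∘ suc) 0ℤ r     ≡⟨ pr ⟩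
  0ℤ                                     ∎
  where
  open ≡-Reasoning
  identity : ∀ a₀ r → a₀ ≡ a₀ +ᶻ r *ᶻ 0ℤ
  identity = solve-∀

roots⇒≡0 : (a : Fin n → ℤ) (r : Fin n → ℤ) → Injective _≡_ _≡_ r →
  (∀ i → eval a 0ℤ (r i) ≡ 0ℤ) → ∀ i → a i ≡ 0ℤ
roots⇒≡0 {suc n} a r inj root = quot≡0⇒≡0 a (r zero) (root zero)
  (roots⇒≡0 (quot a 0ℤ (r zero)) (r ∘ suc) (suc-injective inj)
    (λ i → quot-root a 0ℤ (r zero) (r (suc i)) (Fin.0≢1+n ∘ inj) (root zero) (root (suc i))))

-- Factoring over the last `n` roots and evaluating at the remaining one leaves `l` times a product
-- of nonzero differences.
roots⇒lead≡0 : (a : Fin n → ℤ) (l : ℤ) (r : Fin (suc n) → ℤ) → Injective _≡_ _≡_ r →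
  (∀ i → eval a l (r i) ≡ 0ℤ) → l ≡ 0ℤ
roots⇒lead≡0 a l r inj root =
  *≡0-cancelˡ (∏≢0 (λ i → r zero -ᶻ r (suc i)) (λ i → -≢0 (Fin.0≢1+n ∘ inj))) (begin
    P *ᶻ l               ≡⟨ ℤ.*-comm P l ⟩
    l *ᶻ P               ≡⟨ eval-factor a l (r ∘ suc) (suc-injective inj) (root ∘ suc) (r zero) ⟨
    eval a l (r zero)    ≡⟨ root zero ⟩
    0ℤ                   ∎)
  where
  open ≡-Reasoning
  P = ∏ (λ i → r zero -ᶻ r (suc i))

eval--≡0 : (a b : Fin n → ℤ) (l m x : ℤ) →
  eval a l x ≡ eval b m x → eval (λ i → a i -ᶻ b i) (l -ᶻ m) x ≡ 0ℤ
eval--≡0 a b l m x eq = trans (eval-- a b l m x) (ℤ.i≡j⇒i-j≡0 eq)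

-- With equal leading coefficients the difference has degree below `n`, so `n` points suffice, one
-- fewer than in `eval-injective`.
lower-injective : (a b : Fin n → ℤ) (l : ℤ) (r : Fin n → ℤ) → Injective _≡_ _≡_ r →
  (∀ i → eval a l (r i) ≡ eval b l (r i)) → ∀ i → a i ≡ b i
lower-injective a b l r inj agree i = ℤ.i-j≡0⇒i≡j _ _ (roots⇒≡0 (λ j → a j -ᶻ b j) r inj
  (λ j → subst (λ m → eval (λ j → a j -ᶻ b j) m (r j) ≡ 0ℤ) (ℤ.+-inverseʳ l) (eval--≡0 a b l l (r j) (agree j))) i)

eval-injective : (a b : Fin n → ℤ) (l m : ℤ) (r : Fin (suc n) → ℤ) → Injective _≡_ _≡_ r →
  (∀ i → eval a l (r i) ≡ eval b m (r i)) → l ≡ m × (∀ i → a i ≡ b i)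
eval-injective a b l m r inj agree with ℤ.i-j≡0⇒i≡j l m
  (roots⇒lead≡0 (λ j → a j -ᶻ b j) (l -ᶻ m) r inj (λ i → eval--≡0 a b l m (r i) (agree i)))
... | refl = refl , lower-injective a b l (r ∘ suc) (suc-injective inj) (agree ∘ suc)

-- Compare the factored forms of the first polynomial minus the second and minus the third at r₀,
-- where the last two polynomials agree.
lead-relation : (a b c : Fin (suc n) → ℤ) (l m o : ℤ) (r : Fin (3 + n) → ℤ) → Injective _≡_ _≡_ r →
  (∀ i → i ≢ zero → i ≢ suc zero → eval a l (r i) ≡ eval b m (r i)) →
  (∀ i → i ≢ zero → i ≢ suc (suc zero) → eval a l (r i) ≡ eval c o (r i)) →
  eval b m (r zero) ≡ eval c o (r zero) →
  (r zero -ᶻ r (suc (suc zero))) *ᶻ (l -ᶻ m) ≡ (r zero -ᶻ r (suc zero)) *ᶻ (l -ᶻ o)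
lead-relation {n} a b c l m o r inj ab ac bc =
  -- `P` is the part common to both factorisations; it is nonzero because the positions are
  -- distinct, so it cancels.
  ℤ.i-j≡0⇒i≡j _ _ (*≡0-cancelˡ {P} (∏≢0 (λ i → r₀ -ᶻ r (suc (suc (suc i)))) (λ i → -≢0 (Fin.0≢1+n ∘ inj))) (begin
    P *ᶻ ((r₀ -ᶻ r₂) *ᶻ (l -ᶻ m) -ᶻ (r₀ -ᶻ r₁) *ᶻ (l -ᶻ o))                 ≡⟨ identity P (r₀ -ᶻ r₁) (r₀ -ᶻ r₂) (l -ᶻ m) (l -ᶻ o) ⟩
    (l -ᶻ m) *ᶻ ((r₀ -ᶻ r₂) *ᶻ P) -ᶻ (l -ᶻ o) *ᶻ ((r₀ -ᶻ r₁) *ᶻ P)          ≡⟨ cong₂ _-ᶻ_ ab-factor ac-factor ⟨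
    (eval a l r₀ -ᶻ eval b m r₀) -ᶻ (eval a l r₀ -ᶻ eval c o r₀)            ≡⟨ cong (λ y → (eval a l r₀ -ᶻ y) -ᶻ (eval a l r₀ -ᶻ eval c o r₀)) bc ⟩
    (eval a l r₀ -ᶻ eval c o r₀) -ᶻ (eval a l r₀ -ᶻ eval c o r₀)            ≡⟨ ℤ.+-inverseʳ (eval a l r₀ -ᶻ eval c o r₀) ⟩
    0ℤ                                                                      ∎))
  where
  open ≡-Reasoning
  r₀ = r zero
  r₁ = r (suc zero)
  r₂ = r (suc (suc zero))
  P = ∏ (λ i → r₀ -ᶻ r (suc (suc (suc {n} i))))
  identity : ∀ P y z d e → P *ᶻ (z *ᶻ d -ᶻ y *ᶻ e) ≡ d *ᶻ (z *ᶻ P) -ᶻ e *ᶻ (y *ᶻ P)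
  identity = solve-∀
  -- Runs through the indices 1, 3, 4, ..., at which the first and the third polynomial agree.
  skip : Fin (suc n) → Fin (3 + n)
  skip i = punchIn (suc (suc zero)) (suc i)
  ab-factor : eval a l r₀ -ᶻ eval b m r₀ ≡ (l -ᶻ m) *ᶻ ((r₀ -ᶻ r₂) *ᶻ P)
  ab-factor = trans (sym (eval-- a b l m r₀)) (eval-factor (λ i → a i -ᶻ b i) (l -ᶻ m) (λ i → r (suc (suc i)))
    (suc-injective {r = r ∘ suc} (suc-injective inj))
    (λ i → eval--≡0 a b l m (r (suc (suc i))) (ab (suc (suc i)) (λ ()) (λ ()))) r₀)
  ac-factor : eval a l r₀ -ᶻ eval c o r₀ ≡ (l -ᶻ o) *ᶻ ((r₀ -ᶻ r₁) *ᶻ P)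
  ac-factor = trans (sym (eval-- a c l o r₀)) (eval-factor (λ i → a i -ᶻ c i) (l -ᶻ o) (r ∘ skip)
    (λ eq → Fin.suc-injective (Fin.punchIn-injective (suc (suc zero)) _ _ (inj eq)))
    (λ i → eval--≡0 a c l o (r (skip i)) (ac (skip i) (λ ()) (Fin.punchInᵢ≢i _ (suc i)))) r₀)

-- Sums of squares and strict convexity of the paraboloid

square-≥0 : ∀ i → 0ℤ ℤ.≤ i *ᶻ i
square-≥0 (+ m)    = subst (0ℤ ℤ.≤_) (ℤ.pos-* m m) (ℤ.+≤+ z≤n)
square-≥0 -[1+ m ] = ℤ.+≤+ z≤n

+≡0⇒≡0 : ∀ {i j} → 0ℤ ℤ.≤ i → 0ℤ ℤ.≤ j → i +ᶻ j ≡ 0ℤ → i ≡ 0ℤ × j ≡ 0ℤ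
+≡0⇒≡0 {+ zero} {+ zero} _ _ _ = refl , refl

∑-squares-≥0 : (f : Fin n → ℤ) → 0ℤ ℤ.≤ ∑ (λ i → f i *ᶻ f i)
∑-squares-≥0 {zero}  f = ℤ.+≤+ z≤n
∑-squares-≥0 {suc n} f = ℤ.+-mono-≤ (square-≥0 (f zero)) (∑-squares-≥0 (f ∘ suc))

∑-squares≡0 : (f : Fin n → ℤ) → ∑ (λ i → f i *ᶻ f i) ≡ 0ℤ → ∀ i → f i ≡ 0ℤ
∑-squares≡0 {suc n} f eq with +≡0⇒≡0 (square-≥0 (f zero)) (∑-squares-≥0 (f ∘ suc)) eq
... | f₀²≡0 , rest = λ
  { zero    → [ (λ p → p) , (λ p → p) ]′ (ℤ.i*j≡0⇒i≡0∨j≡0 (f zero) f₀²≡0)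
  ; (suc i) → ∑-squares≡0 (f ∘ suc) rest i }

-- Measures how far squared norms are from inheriting the affine relation between `x`, `y` and `z`:
-- the defect is a multiple of `|x - z|²`. The outer factor `u` replaces the division by `u` that
-- eliminating `y` would require.
norm-identity : (u v : ℤ) (x y z : Fin n → ℤ) → (∀ i → u *ᶻ (x i -ᶻ y i) ≡ v *ᶻ (x i -ᶻ z i)) →
  u *ᶻ (u *ᶻ (∑ (λ i → x i *ᶻ x i) -ᶻ ∑ (λ i → y i *ᶻ y i)) -ᶻ v *ᶻ (∑ (λ i → x i *ᶻ x i) -ᶻ ∑ (λ i → z i *ᶻ z i)))
    ≡ (v *ᶻ (u -ᶻ v)) *ᶻ ∑ (λ i → (x i -ᶻ z i) *ᶻ (x i -ᶻ z i))
norm-identity {zero}  u v x y z prop = identity u v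
  where
  identity : ∀ u v → u *ᶻ (u *ᶻ (0ℤ -ᶻ 0ℤ) -ᶻ v *ᶻ (0ℤ -ᶻ 0ℤ)) ≡ (v *ᶻ (u -ᶻ v)) *ᶻ 0ℤ
  identity = solve-∀
norm-identity {suc n} u v x y z prop = begin
  u *ᶻ (u *ᶻ ((x₀ *ᶻ x₀ +ᶻ X) -ᶻ (y₀ *ᶻ y₀ +ᶻ Y)) -ᶻ v *ᶻ ((x₀ *ᶻ x₀ +ᶻ X) -ᶻ (z₀ *ᶻ z₀ +ᶻ Z)))
    ≡⟨ split u v x₀ y₀ z₀ X Y Z ⟩
  u *ᶻ (u *ᶻ (X -ᶻ Y) -ᶻ v *ᶻ (X -ᶻ Z))
    +ᶻ (v *ᶻ (u -ᶻ v)) *ᶻ ((x₀ -ᶻ z₀) *ᶻ (x₀ -ᶻ z₀))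
    +ᶻ (u *ᶻ (x₀ -ᶻ y₀) -ᶻ v *ᶻ (x₀ -ᶻ z₀)) *ᶻ w
    ≡⟨ cong₂ (λ p q → p +ᶻ (v *ᶻ (u -ᶻ v)) *ᶻ ((x₀ -ᶻ z₀) *ᶻ (x₀ -ᶻ z₀)) +ᶻ q *ᶻ w)
         (norm-identity u v (x ∘ suc) (y ∘ suc) (z ∘ suc) (prop ∘ suc)) (ℤ.i≡j⇒i-j≡0 (prop zero)) ⟩
  (v *ᶻ (u -ᶻ v)) *ᶻ N +ᶻ (v *ᶻ (u -ᶻ v)) *ᶻ ((x₀ -ᶻ z₀) *ᶻ (x₀ -ᶻ z₀)) +ᶻ 0ℤ *ᶻ w
    ≡⟨ merge (v *ᶻ (u -ᶻ v)) N ((x₀ -ᶻ z₀) *ᶻ (x₀ -ᶻ z₀)) w ⟩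
  (v *ᶻ (u -ᶻ v)) *ᶻ ((x₀ -ᶻ z₀) *ᶻ (x₀ -ᶻ z₀) +ᶻ N) ∎
  where
  open ≡-Reasoning
  x₀ = x zero
  y₀ = y zero
  z₀ = z zero
  X = ∑ (λ i → x (suc i) *ᶻ x (suc i))
  Y = ∑ (λ i → y (suc i) *ᶻ y (suc i))
  Z = ∑ (λ i → z (suc i) *ᶻ z (suc i))
  N = ∑ (λ i → (x (suc i) -ᶻ z (suc i)) *ᶻ (x (suc i) -ᶻ z (suc i)))
  -- The identity in coordinate 0 holds up to a multiple of `u (x₀ - y₀) - v (x₀ - z₀)`, which
  -- vanishes by `prop`; `w` is the cofactor.
  w = (+ 2) *ᶻ x₀ *ᶻ u -ᶻ u *ᶻ (x₀ -ᶻ y₀) -ᶻ v *ᶻ (x₀ -ᶻ z₀)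
  split : ∀ u v x₀ y₀ z₀ X Y Z →
    u *ᶻ (u *ᶻ ((x₀ *ᶻ x₀ +ᶻ X) -ᶻ (y₀ *ᶻ y₀ +ᶻ Y)) -ᶻ v *ᶻ ((x₀ *ᶻ x₀ +ᶻ X) -ᶻ (z₀ *ᶻ z₀ +ᶻ Z)))
      ≡ u *ᶻ (u *ᶻ (X -ᶻ Y) -ᶻ v *ᶻ (X -ᶻ Z))
        +ᶻ (v *ᶻ (u -ᶻ v)) *ᶻ ((x₀ -ᶻ z₀) *ᶻ (x₀ -ᶻ z₀))
        +ᶻ (u *ᶻ (x₀ -ᶻ y₀) -ᶻ v *ᶻ (x₀ -ᶻ z₀)) *ᶻ ((+ 2) *ᶻ x₀ *ᶻ u -ᶻ u *ᶻ (x₀ -ᶻ y₀) -ᶻ v *ᶻ (x₀ -ᶻ z₀))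
  split = solve-∀
  merge : ∀ c N s w → c *ᶻ N +ᶻ c *ᶻ s +ᶻ 0ℤ *ᶻ w ≡ c *ᶻ (s +ᶻ N)
  merge = solve-∀

-- A line meets the paraboloid in at most two points: if the relation also holds for the squared
-- norms, `norm-identity` leaves `v (u - v) |x - z|² = 0`.
paraboloid-strictly-convex : (u v : ℤ) (x y z : Fin n → ℤ) → v ≢ 0ℤ → u ≢ v →
  (∀ i → u *ᶻ (x i -ᶻ y i) ≡ v *ᶻ (x i -ᶻ z i)) →
  u *ᶻ (∑ (λ i → x i *ᶻ x i) -ᶻ ∑ (λ i → y i *ᶻ y i)) ≡ v *ᶻ (∑ (λ i → x i *ᶻ x i) -ᶻ ∑ (λ i → z i *ᶻ z i)) →
  ∀ i → x i ≡ z i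
paraboloid-strictly-convex u v x y z v≢0 u≢v prop norms i =
  ℤ.i-j≡0⇒i≡j _ _ (∑-squares≡0 (λ i → x i -ᶻ z i) norm≡0 i)
  where
  norm≡0 : ∑ (λ i → (x i -ᶻ z i) *ᶻ (x i -ᶻ z i)) ≡ 0ℤ
  norm≡0 = *≡0-cancelˡ {v *ᶻ (u -ᶻ v)} (-≢0 u≢v ∘ *≡0-cancelˡ v≢0)
    (trans (sym (norm-identity u v x y z prop))
      (trans (cong (u *ᶻ_) (ℤ.i≡j⇒i-j≡0 norms)) (ℤ.*-zeroʳ u)))

-- Images of subsets, packings and tight triangles

⌊⌋≡true⁻ : {A : Set} (a? : Dec A) → ⌊ a? ⌋ ≡ true → A
⌊⌋≡true⁻ a? eq = toWitness {a? = a?} (Equivalence.from Bool.T-≡ eq)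

⌊⌋≡true⁺ : {A : Set} (a? : Dec A) → A → ⌊ a? ⌋ ≡ true
⌊⌋≡true⁺ a? a = Equivalence.to Bool.T-≡ (fromWitness {a? = a?} a)

module _ {a b : ℕ} (φ : Fin a → Fin b) (p : Subset a) where

  private
    -- Repeats the decision made inside `image`, so that its Boolean value converts to and from a
    -- witness.
    inImage? : (j : Fin b) → Dec (∃ λ i → lookup p i ∧ ⌊ φ i Fin.≟ j ⌋ ≡ true)
    inImage? j = Fin.any? (λ i → Bool._≟_ (lookup p i ∧ ⌊ φ i Fin.≟ j ⌋) true)

  ∈-image⁻ : ∀ {j} → j ∈ image φ p → ∃[ i ] i ∈ p × φ i ≡ j
  ∈-image⁻ {j} j∈ with ⌊⌋≡true⁻ (inImage? j) (trans (sym (lookup∘tabulate _ j)) ([]=⇒lookup j∈))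
  ... | i , eq with lookup p i in pi | φ i Fin.≟ j
  ...   | true | yes φi≡j = i , lookup⇒[]= i p pi , φi≡j

  ∈-image⁺ : ∀ {i} → i ∈ p → φ i ∈ image φ p
  ∈-image⁺ {i} i∈ = lookup⇒[]= (φ i) _ (trans (lookup∘tabulate _ (φ i))
    (⌊⌋≡true⁺ (inImage? (φ i)) (i , cong₂ _∧_ ([]=⇒lookup i∈) (⌊⌋≡true⁺ (φ i Fin.≟ φ i) refl))))

image-cong-⊆ : {a b : ℕ} (φ ψ : Fin a → Fin b) (p : Subset a) → (∀ {i} → i ∈ p → φ i ≡ ψ i) →
  image φ p ⊆ image ψ p
image-cong-⊆ φ ψ p eq j∈ with ∈-image⁻ φ p j∈
... | i , i∈ , refl = subst (_∈ image ψ p) (sym (eq i∈)) (∈-image⁺ ψ p i∈)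

image-cong : {a b : ℕ} (φ ψ : Fin a → Fin b) (p : Subset a) → (∀ {i} → i ∈ p → φ i ≡ ψ i) →
  image φ p ≡ image ψ p
image-cong φ ψ p eq = Subset.⊆-antisym (image-cong-⊆ φ ψ p eq) (image-cong-⊆ ψ φ p (sym ∘ eq))

enum : (p : Subset n) → Fin ∣ p ∣ → Fin n
enum (inside  ∷ p) zero    = zero
enum (inside  ∷ p) (suc i) = suc (enum p i)
enum (outside ∷ p) i       = suc (enum p i)

enum-∈ : (p : Subset n) (i : Fin ∣ p ∣) → enum p i ∈ p
enum-∈ (inside  ∷ p) zero    = here
enum-∈ (inside  ∷ p) (suc i) = there (enum-∈ p i)
enum-∈ (outside ∷ p) i       = there (enum-∈ p i)

enum-injective : (p : Subset n) → Injective _≡_ _≡_ (enum p)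
enum-injective (inside  ∷ p) {zero}  {zero}  eq = refl
enum-injective (inside  ∷ p) {suc i} {suc j} eq = cong suc (enum-injective p (Fin.suc-injective eq))
enum-injective (outside ∷ p) eq = enum-injective p (Fin.suc-injective eq)

enum-surjective : (p : Subset n) {x : Fin n} → x ∈ p → ∃[ i ] enum p i ≡ x
enum-surjective (inside  ∷ p) here = zero , refl
enum-surjective (inside  ∷ p) (there x∈) with enum-surjective p x∈
... | i , refl = suc i , refl
enum-surjective (outside ∷ p) (there x∈) with enum-surjective p x∈
... | i , refl = i , refl

enumerate : ∀ {k} (p : Subset n) → ∣ p ∣ ≡ k → ∃ λ (r : Fin k → Fin n) → Injective _≡_ _≡_ r × (∀ i → r i ∈ p)
enumerate p refl = enum p , enum-injective p , enum-∈ p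

-- Injections between the enumerations in both directions: `forth` is injective because `φ` is, the
-- choice of preimages because `φ` undoes it.
∣image∣ : {a b : ℕ} (φ : Fin a → Fin b) → Injective _≡_ _≡_ φ → (p : Subset a) → ∣ image φ p ∣ ≡ ∣ p ∣
∣image∣ φ φ-inj p = ℕ.≤-antisym (Fin.injective⇒≤ back-injective) (Fin.injective⇒≤ forth-injective)
  where
  open ≡-Reasoning
  q = image φ p
  forth : Fin ∣ p ∣ → Fin ∣ q ∣
  forth i = proj₁ (enum-surjective q (∈-image⁺ φ p (enum-∈ p i)))
  enum-forth : ∀ i → enum q (forth i) ≡ φ (enum p i)
  enum-forth i = proj₂ (enum-surjective q (∈-image⁺ φ p (enum-∈ p i)))
  forth-injective : Injective _≡_ _≡_ forth
  forth-injective {i} {j} eq = enum-injective p (φ-inj (begin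
    φ (enum p i)        ≡⟨ enum-forth i ⟨
    enum q (forth i)    ≡⟨ cong (enum q) eq ⟩
    enum q (forth j)    ≡⟨ enum-forth j ⟩
    φ (enum p j)        ∎))
  preimage : ∀ j → ∃[ i ] φ (enum p i) ≡ enum q j
  preimage j with ∈-image⁻ φ p (enum-∈ q j)
  ... | x , x∈ , φx≡ with enum-surjective p x∈
  ...   | i , refl = i , φx≡
  back-injective : Injective _≡_ _≡_ (proj₁ ∘ preimage)
  back-injective {i} {j} eq = enum-injective q (begin
    enum q i                           ≡⟨ proj₂ (preimage i) ⟨
    φ (enum p (proj₁ (preimage i)))    ≡⟨ cong (φ ∘ enum p) eq ⟩
    φ (enum p (proj₁ (preimage j)))    ≡⟨ proj₂ (preimage j) ⟩
    enum q j                           ∎)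

-- A copy restricted to `f` is a map from `∣ f ∣` points to `n` vertices, coded as a number below
-- `n ^ ∣ f ∣`. Two colours with the same code would share the image of `f` as an edge.
packing-size : {F : Hypergraph} {n : ℕ} (P : Packing F n) (f : Subset (V F)) → Edge F f → m P ≤ n ^ ∣ f ∣
packing-size {F} {n} P f f∈F = Fin.injective⇒≤ {f = restrict} restrict-injective
  where
  restrict : Fin (m P) → Fin (n ^ ∣ f ∣)
  restrict c = funToFin (copy P c ∘ enum f)
  restrict-injective : Injective _≡_ _≡_ restrict
  restrict-injective {c} {d} eq with c Fin.≟ d
  ... | yes c≡d = c≡d
  ... | no  c≢d = contradiction (f , f∈F , image-cong (copy P d) (copy P c) f agree)
                    (disjoint P c d c≢d (image (copy P c) f) (f , f∈F , refl))
    where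
    agree : ∀ {x} → x ∈ f → copy P d x ≡ copy P c x
    agree x∈ with enum-surjective f x∈
    ... | i , refl = begin
      copy P d (enum f i)       ≡⟨ Fin.finToFun-funToFin (copy P d ∘ enum f) i ⟨
      finToFun (restrict d) i   ≡⟨ cong (λ z → finToFun z i) eq ⟨
      finToFun (restrict c) i   ≡⟨ Fin.finToFun-funToFin (copy P c ∘ enum f) i ⟩
      copy P c (enum f i)       ∎
      where open ≡-Reasoning

-- Tight triangles and packings that avoid them

∈∁⁅⁆ : {x y : Fin n} → x ≢ y → x ∈ ∁ ⁅ y ⁆
∈∁⁅⁆ x≢y = Subset.x∉p⇒x∈∁p (Subset.x≢y⇒x∉⁅y⁆ x≢y)

∉∁⁅⁆ : (x : Fin n) → x ∉ ∁ ⁅ x ⁆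
∉∁⁅⁆ x = Subset.x∈p⇒x∉∁p (Subset.x∈⁅x⁆ x)

∣∁⁅⁆∣ : (x : Fin (suc n)) → ∣ ∁ ⁅ x ⁆ ∣ ≡ n
∣∁⁅⁆∣ {n} x = trans (Subset.∣∁p∣≡n∸∣p∣ ⁅ x ⁆) (cong (suc n ∸_) (Subset.∣⁅x⁆∣≡1 x))

H3-uniform : ∀ k′ → Uniform (2 + k′) (H3 k′)
H3-uniform k′ e (inj₁ refl)        = ∣∁⁅⁆∣ {2 + k′} zero
H3-uniform k′ e (inj₂ (inj₁ refl)) = ∣∁⁅⁆∣ {2 + k′} (suc zero)
H3-uniform k′ e (inj₂ (inj₂ refl)) = ∣∁⁅⁆∣ {2 + k′} (suc (suc zero))

K-contains-H3 : ∀ k′ r → 3 + k′ ≤ r → ContainsCopy (K (2 + k′) r) (H3 k′)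
K-contains-H3 k′ r 3+k′≤r = (λ i → inject≤ i 3+k′≤r) , inj , λ e e∈ →
  trans (∣image∣ (λ i → inject≤ i 3+k′≤r) inj e) (H3-uniform k′ e e∈)
  where
  inj : Injective _≡_ _≡_ (λ (i : Fin (3 + k′)) → inject≤ i 3+k′≤r)
  inj = Fin.inject≤-injective 3+k′≤r 3+k′≤r _ _

-- In a tight triangle whose i-th vertex has position r i, the edge of colour cᵢ misses exactly
-- the vertex i, for i = 0, 1, 2; triangle says that it is not rainbow.
record TriangleFreeFamily (k′ t m n : ℕ) : Set where
  field
    vertex   : Fin m → Fin t → Fin n
    position : ∀ {c c′ j j′} → vertex c j ≡ vertex c′ j′ → j ≡ j′
    sparse   : ∀ c c′ (r : Fin (2 + k′) → Fin t) → Injective _≡_ _≡_ r →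
               (∀ i → vertex c (r i) ≡ vertex c′ (r i)) → c ≡ c′
    triangle : ∀ c₀ c₁ c₂ (r : Fin (3 + k′) → Fin t) → Injective _≡_ _≡_ r →
               (∀ i → i ≢ zero → i ≢ suc zero → vertex c₀ (r i) ≡ vertex c₁ (r i)) →
               (∀ i → i ≢ zero → i ≢ suc (suc zero) → vertex c₀ (r i) ≡ vertex c₂ (r i)) →
               vertex c₁ (r zero) ≡ vertex c₂ (r zero) → c₀ ≡ c₂

module _ {k′ m n : ℕ} (F : Hypergraph) (F-uniform : Uniform (2 + k′) F)
         (family : TriangleFreeFamily k′ (V F) m n) where

  open TriangleFreeFamily family

  private
    -- A vertex determines its position, so a common vertex has the same position in both copies,
    -- and the two colours agree on all of `f`.
    shared-edge : ∀ c d e → CopyEdge F (vertex c) e → CopyEdge F (vertex d) e → c ≡ d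
    shared-edge c d e (f , f∈F , refl) (g , g∈F , eq) with enumerate f (F-uniform f f∈F)
    ... | r , r-inj , r∈f = sparse c d r r-inj (agree ∘ r∈f)
      where
      agree : ∀ {j} → j ∈ f → vertex c j ≡ vertex d j
      agree j∈ with ∈-image⁻ (vertex d) g (subst (_ ∈_) (sym eq) (∈-image⁺ (vertex c) f j∈))
      ... | j′ , _ , eq′ with position eq′
      ...   | refl = sym eq′

  familyPacking : Packing F n
  familyPacking = record
    { m        = m
    ; copy     = vertex
    ; copyInj  = λ c → position
    ; disjoint = λ c d c≢d e ec ed → c≢d (shared-edge c d e ec ed)
    }

  -- A rainbow `G` contains a rainbow tight triangle. Its vertices have distinct positions, so
  -- `triangle` identifies two of its colours, and hence two distinct edges.
  family-noRainbow : (G : Hypergraph) → ContainsCopy G (H3 k′) → ¬ RainbowCopy familyPacking G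
  family-noRainbow G (ψ , ψ-inj , ψ-edge) (χ , χ-inj , col , col-copy , col-inj) = e₀≢e₂ e₀≡e₂
    where
    corner : Fin 3 → Fin (3 + k′)
    corner zero             = zero
    corner (suc zero)       = suc zero
    corner (suc (suc zero)) = suc (suc zero)

    H3-edge : ∀ w → Edge (H3 k′) (∁ ⁅ corner w ⁆)
    H3-edge zero             = inj₁ refl
    H3-edge (suc zero)       = inj₂ (inj₁ refl)
    H3-edge (suc (suc zero)) = inj₂ (inj₂ refl)

    edge : Fin 3 → Subset (V G)
    edge w = image ψ (∁ ⁅ corner w ⁆)

    edge∈G : ∀ w → Edge G (edge w)
    edge∈G w = ψ-edge _ (H3-edge w)

    colour : Fin 3 → Fin m
    colour w = col (edge w) (edge∈G w)

    θ : Fin (3 + k′) → Fin n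
    θ = χ ∘ ψ

    covered : ∀ w v → v ≢ corner w → ∃[ j ] vertex (colour w) j ≡ θ v
    covered w v v≢w =
      let f , _ , eq = col-copy (edge w) (edge∈G w)
          v∈ = ∈-image⁺ χ (edge w) (∈-image⁺ ψ (∁ ⁅ corner w ⁆) (∈∁⁅⁆ v≢w))
          j , _ , eq′ = ∈-image⁻ (vertex (colour w)) f (subst (θ v ∈_) (sym eq) v∈)
      in j , eq′

    -- Any two vertices lie in a common edge of the triangle: they exclude at most two of the three
    -- corners.
    avoid : ∀ u v → ∃[ w ] u ≢ corner w × v ≢ corner w
    avoid zero          zero          = suc zero , (λ ()) , (λ ())
    avoid zero          (suc zero)    = suc (suc zero) , (λ ()) , (λ ())
    avoid zero          (suc (suc v)) = suc zero , (λ ()) , (λ ())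
    avoid (suc zero)    zero          = suc (suc zero) , (λ ()) , (λ ())
    avoid (suc zero)    (suc v)       = zero , (λ ()) , (λ ())
    avoid (suc (suc u)) zero          = suc zero , (λ ()) , (λ ())
    avoid (suc (suc u)) (suc v)       = zero , (λ ()) , (λ ())

    π : Fin (3 + k′) → Fin (V F)
    π v = let w , v≢w , _ = avoid v v in proj₁ (covered w v v≢w)

    -- `π v` is read off from one edge through `v`; by `position`, every other edge through `v`
    -- gives the same value.
    vertex-π : ∀ w v → v ≢ corner w → vertex (colour w) (π v) ≡ θ v
    vertex-π w v v≢w =
      let j , eq = covered w v v≢w
          w′ , v≢w′ , _ = avoid v v
          _ , eq′ = covered w′ v v≢w′
      in trans (cong (vertex (colour w)) (position (trans eq′ (sym eq)))) eq

    π-injective : Injective _≡_ _≡_ π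
    π-injective {u} {v} eq = let w , u≢w , v≢w = avoid u v in ψ-inj (χ-inj (begin
      θ u                        ≡⟨ vertex-π w u u≢w ⟨
      vertex (colour w) (π u)    ≡⟨ cong (vertex (colour w)) eq ⟩
      vertex (colour w) (π v)    ≡⟨ vertex-π w v v≢w ⟩
      θ v                        ∎))
      where open ≡-Reasoning

    agree : ∀ w w′ v → v ≢ corner w → v ≢ corner w′ → vertex (colour w) (π v) ≡ vertex (colour w′) (π v)
    agree w w′ v v≢w v≢w′ = trans (vertex-π w v v≢w) (sym (vertex-π w′ v v≢w′))

    same-colour : colour zero ≡ colour (suc (suc zero))
    same-colour = triangle _ _ _ π π-injective
      (agree zero (suc zero)) (agree zero (suc (suc zero)))
      (agree (suc zero) (suc (suc zero)) zero (λ ()) (λ ()))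

    e₀≡e₂ : edge zero ≡ edge (suc (suc zero))
    e₀≡e₂ = col-inj _ _ (edge∈G zero) (edge∈G (suc (suc zero))) same-colour

    e₀≢e₂ : edge zero ≢ edge (suc (suc zero))
    -- Corner 2 belongs to the edge opposite corner 0 but not to the edge opposite itself.
    e₀≢e₂ eq with ∈-image⁻ ψ (∁ ⁅ suc (suc zero) ⁆)
                    (subst (ψ (suc (suc zero)) ∈_) eq (∈-image⁺ ψ (∁ ⁅ zero ⁆) (∈∁⁅⁆ {y = zero} (λ ()))))
    ... | i , i∈ , ψi≡ with ψ-inj ψi≡
    ...   | refl = ∉∁⁅⁆ (suc (suc zero)) i∈

-- The family of polynomial colours

-- Colours and vertices are coded in `Fin`, so coefficients and values are natural numbers here;
-- `eval-pos` transfers the root arguments from ℤ.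
evalℕ : (Fin n → ℕ) → ℕ → ℕ → ℕ
evalℕ {zero}  a l x = l
evalℕ {suc n} a l x = a zero + x * evalℕ (a ∘ suc) l x

eval-pos : (a : Fin n → ℕ) (l x : ℕ) → eval (λ i → + a i) (+ l) (+ x) ≡ + evalℕ a l x
eval-pos {zero}  a l x = refl
eval-pos {suc n} a l x = begin
  + a zero +ᶻ + x *ᶻ eval (λ i → + a (suc i)) (+ l) (+ x)  ≡⟨ cong (λ y → + a zero +ᶻ + x *ᶻ y) (eval-pos (a ∘ suc) l x) ⟩
  + a zero +ᶻ + x *ᶻ + evalℕ (a ∘ suc) l x                 ≡⟨ cong (+ a zero +ᶻ_) (ℤ.pos-* x (evalℕ (a ∘ suc) l x)) ⟨
  + a zero +ᶻ + (x * evalℕ (a ∘ suc) l x)                  ≡⟨ ℤ.pos-+ (a zero) (x * evalℕ (a ∘ suc) l x) ⟨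
  + (a zero + x * evalℕ (a ∘ suc) l x)                     ∎
  where open ≡-Reasoning

∑-squares-pos : (f : Fin n → ℕ) → ∑ (λ i → + f i *ᶻ + f i) ≡ + ∑ℕ (λ i → f i * f i)
∑-squares-pos {zero}  f = refl
∑-squares-pos {suc n} f = begin
  + f zero *ᶻ + f zero +ᶻ ∑ (λ i → + f (suc i) *ᶻ + f (suc i))   ≡⟨ cong₂ _+ᶻ_ (sym (ℤ.pos-* (f zero) (f zero))) (∑-squares-pos (f ∘ suc)) ⟩
  + (f zero * f zero) +ᶻ + ∑ℕ (λ i → f (suc i) * f (suc i))      ≡⟨ ℤ.pos-+ (f zero * f zero) (∑ℕ (λ i → f (suc i) * f (suc i))) ⟨
  + ∑ℕ (λ i → f i * f i)                                         ∎
  where open ≡-Reasoning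

-- Each Horner step multiplies the bound by at most `suc t`, because `B` is itself below the bound
-- already reached.
evalℕ-< : ∀ {B t x} (a : Fin n → ℕ) (l : ℕ) → (∀ i → a i < B) → l < B → x ≤ t →
  evalℕ a l x < suc t ^ n * B
evalℕ-< {zero}  {B} a l a<B l<B x≤t = subst (l <_) (sym (ℕ.*-identityˡ B)) l<B
evalℕ-< {suc n} {B} {t} {x} a l a<B l<B x≤t = begin-strict
  a zero + x * evalℕ (a ∘ suc) l x              <⟨ ℕ.+-mono-<-≤ (a<B zero) (ℕ.*-mono-≤ x≤t (ℕ.<⇒≤ (evalℕ-< (a ∘ suc) l (a<B ∘ suc) l<B x≤t))) ⟩
  B + t * (suc t ^ n * B)                       ≤⟨ ℕ.+-monoˡ-≤ _ (ℕ.m≤n*m B (suc t ^ n) {{ℕ.m^n≢0 (suc t) n}}) ⟩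
  suc t * (suc t ^ n * B)                       ≡⟨ ℕ.*-assoc (suc t) (suc t ^ n) B ⟨
  suc t ^ suc n * B                             ∎
  where open ℕ.≤-Reasoning

∑ℕ-≤ : ∀ {B} (f : Fin n → ℕ) → (∀ i → f i < B) → ∑ℕ f ≤ n * B
∑ℕ-≤ {zero}  f f<B = z≤n
∑ℕ-≤ {suc n} f f<B = ℕ.+-mono-≤ (ℕ.<⇒≤ (f<B zero)) (∑ℕ-≤ (f ∘ suc) (f<B ∘ suc))

∑ℕ-< : ∀ {B} (f : Fin (suc n) → ℕ) → (∀ i → f i < B) → ∑ℕ f < suc n * B
∑ℕ-< f f<B = ℕ.+-mono-<-≤ (f<B zero) (∑ℕ-≤ (f ∘ suc) (f<B ∘ suc))

quotient-remainder-injective : ∀ m n (x y : Fin (m * n)) →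
  quotient {m} n x ≡ quotient {m} n y → remainder {m} n x ≡ remainder {m} n y → x ≡ y
quotient-remainder-injective m n x y q≡ r≡ = begin
  x                                                ≡⟨ Fin.combine-remQuot {m} n x ⟨
  combine (quotient {m} n x) (remainder {m} n x)   ≡⟨ cong₂ combine q≡ r≡ ⟩
  combine (quotient {m} n y) (remainder {m} n y)   ≡⟨ Fin.combine-remQuot {m} n y ⟩
  y                                                ∎
  where open ≡-Reasoning

finToFun-injective : ∀ m n (x y : Fin (m ^ n)) → (∀ i → finToFun {m} {n} x i ≡ finToFun {m} {n} y i) → x ≡ y
finToFun-injective m n x y eq = begin
  x                              ≡⟨ Fin.funToFin-finToFin {n} {m} x ⟨
  funToFin (finToFun {m} {n} x)  ≡⟨ funToFin-cong eq ⟩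
  funToFin (finToFun {m} {n} y)  ≡⟨ Fin.funToFin-finToFin {n} {m} y ⟩
  y                              ∎
  where
  open ≡-Reasoning
  funToFin-cong : ∀ {k} {f g : Fin k → Fin m} → (∀ i → f i ≡ g i) → funToFin f ≡ funToFin g
  funToFin-cong {zero}  f≗g = refl
  funToFin-cong {suc k} f≗g = cong₂ combine (f≗g zero) (funToFin-cong (λ i → f≗g (suc i)))

funToFin-injective : ∀ {m n} (f g : Fin m → Fin n) → funToFin f ≡ funToFin g → ∀ i → f i ≡ g i
funToFin-injective f g eq i = begin
  f i                        ≡⟨ Fin.finToFun-funToFin f i ⟨
  finToFun (funToFin f) i    ≡⟨ cong (λ z → finToFun z i) eq ⟩
  finToFun (funToFin g) i    ≡⟨ Fin.finToFun-funToFin g i ⟩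
  g i                        ∎
  where open ≡-Reasoning

eval-pos-cong : (a b : Fin n → ℕ) (l m x : ℕ) → evalℕ a l x ≡ evalℕ b m x →
  eval (λ i → + a i) (+ l) (+ x) ≡ eval (λ i → + b i) (+ m) (+ x)
eval-pos-cong a b l m x eq = trans (eval-pos a l x) (trans (cong +_ eq) (sym (eval-pos b m x)))

evalℕ-lower-injective : (a b : Fin n → ℕ) (l : ℕ) (r : Fin n → ℕ) → Injective _≡_ _≡_ r →
  (∀ i → evalℕ a l (r i) ≡ evalℕ b l (r i)) → ∀ i → a i ≡ b i
evalℕ-lower-injective a b l r r-inj agree i = ℤ.+-injective
  (lower-injective (λ i → + a i) (λ i → + b i) (+ l) (λ i → + r i) (r-inj ∘ ℤ.+-injective)
    (λ i → eval-pos-cong a b l l (r i) (agree i)) i)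

evalℕ-injective : (a b : Fin n → ℕ) (l m : ℕ) (r : Fin (suc n) → ℕ) → Injective _≡_ _≡_ r →
  (∀ i → evalℕ a l (r i) ≡ evalℕ b m (r i)) → l ≡ m × (∀ i → a i ≡ b i)
evalℕ-injective a b l m r r-inj agree =
  let l≡m , a≡b = eval-injective (λ i → + a i) (λ i → + b i) (+ l) (+ m) (λ i → + r i) (r-inj ∘ ℤ.+-injective)
                    (λ i → eval-pos-cong a b l m (r i) (agree i))
  in ℤ.+-injective l≡m , λ i → ℤ.+-injective (a≡b i)

leadℕ-relation : (a b c : Fin (suc n) → ℕ) (l m o : ℕ) (r : Fin (3 + n) → ℕ) → Injective _≡_ _≡_ r →
  (∀ i → i ≢ zero → i ≢ suc zero → evalℕ a l (r i) ≡ evalℕ b m (r i)) →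
  (∀ i → i ≢ zero → i ≢ suc (suc zero) → evalℕ a l (r i) ≡ evalℕ c o (r i)) →
  evalℕ b m (r zero) ≡ evalℕ c o (r zero) →
  (+ r zero -ᶻ + r (suc (suc zero))) *ᶻ (+ l -ᶻ + m) ≡ (+ r zero -ᶻ + r (suc zero)) *ᶻ (+ l -ᶻ + o)
leadℕ-relation a b c l m o r r-inj ab ac bc =
  lead-relation (λ i → + a i) (λ i → + b i) (λ i → + c i) (+ l) (+ m) (+ o) (λ i → + r i) (r-inj ∘ ℤ.+-injective)
    (λ i i≢0 i≢1 → eval-pos-cong a b l m (r i) (ab i i≢0 i≢1))
    (λ i i≢0 i≢2 → eval-pos-cong a c l o (r i) (ac i i≢0 i≢2))
    (eval-pos-cong b c m o (r zero) bc)

-- Colours are polynomials of degree 1 + k′ with coefficients in ℕᴰ × ℕ whose leading coefficient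
-- (x , |x|²) lies on a paraboloid; the vertex of c in position j is the pair (j , c(j)).
module Construction (k′ t D₁ d : ℕ) where

  -- `M` bounds the squared norm of a point with `D` coordinates below `d`, strictly since `D` is
  -- positive; `C` bounds the growth under evaluation at positions up to `t`. In `colours`, `d ^ D`
  -- counts leading coefficients: their last coordinate is not free.
  D M C colours vertices : ℕ
  D = suc D₁
  M = D * (d * d)
  C = suc t ^ (1 + k′)
  colours = d ^ D * (d ^ D * M) ^ (1 + k′)
  vertices = suc t * ((C * d) ^ D * (C * M))

  Colour : Set
  Colour = Fin colours

  lead : Colour → Fin D → Fin d
  lead c = finToFun {d} {D} (quotient {d ^ D} ((d ^ D * M) ^ (1 + k′)) c)

  private
    lows : Colour → Fin (1 + k′) → Fin (d ^ D * M)
    lows c = finToFun {d ^ D * M} {1 + k′} (remainder {d ^ D} ((d ^ D * M) ^ (1 + k′)) c)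

  low : Colour → Fin (1 + k′) → Fin D → Fin d
  low c l = finToFun {d} {D} (quotient {d ^ D} M (lows c l))

  lowNorm : Colour → Fin (1 + k′) → Fin M
  lowNorm c l = remainder {d ^ D} M (lows c l)

  colour-≡ : ∀ c c′ → (∀ i → lead c i ≡ lead c′ i) → (∀ l i → low c l i ≡ low c′ l i) →
    (∀ l → lowNorm c l ≡ lowNorm c′ l) → c ≡ c′
  colour-≡ c c′ lead≡ low≡ lowNorm≡ = quotient-remainder-injective (d ^ D) ((d ^ D * M) ^ (1 + k′)) c c′
    (finToFun-injective d D _ _ lead≡)
    (finToFun-injective (d ^ D * M) (1 + k′) _ _ λ l →
      quotient-remainder-injective (d ^ D) M (lows c l) (lows c′ l)
        (finToFun-injective d D _ _ (low≡ l)) (lowNorm≡ l))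

  leadNorm : Colour → ℕ
  leadNorm c = ∑ℕ (λ i → toℕ (lead c i) * toℕ (lead c i))

  coordinate : Colour → Fin D → ℕ → ℕ
  coordinate c i = evalℕ (λ l → toℕ (low c l i)) (toℕ (lead c i))

  norm : Colour → ℕ → ℕ
  norm c = evalℕ (λ l → toℕ (lowNorm c l)) (leadNorm c)

  coordinate-< : ∀ c i {j} → j ≤ t → coordinate c i j < C * d
  coordinate-< c i = evalℕ-< _ _ (λ l → Fin.toℕ<n (low c l i)) (Fin.toℕ<n (lead c i))

  norm-< : ∀ c {j} → j ≤ t → norm c j < C * M
  norm-< c = evalℕ-< _ _ (λ l → Fin.toℕ<n (lowNorm c l))
    (∑ℕ-< _ (λ i → ℕ.*-mono-< (Fin.toℕ<n (lead c i)) (Fin.toℕ<n (lead c i))))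

  coordinates : Colour → Fin (suc t) → Fin D → Fin (C * d)
  coordinates c j i = fromℕ< (coordinate-< c i (Fin.toℕ≤pred[n] j))

  normValue : Colour → Fin (suc t) → Fin (C * M)
  normValue c j = fromℕ< (norm-< c (Fin.toℕ≤pred[n] j))

  vertex : Colour → Fin (suc t) → Fin vertices
  vertex c j = combine j (combine (funToFin (coordinates c j)) (normValue c j))

  module _ (c c′ : Colour) (j j′ : Fin (suc t)) (eq : vertex c j ≡ vertex c′ j′) where

    private
      values : combine (funToFin (coordinates c j)) (normValue c j) ≡
               combine (funToFin (coordinates c′ j′)) (normValue c′ j′)
      values = Fin.combine-injectiveʳ j _ j′ _ eq

    vertex-position : j ≡ j′
    vertex-position = Fin.combine-injectiveˡ j _ j′ _ eq

    vertex-coordinate : ∀ i → coordinate c i (toℕ j) ≡ coordinate c′ i (toℕ j′)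
    vertex-coordinate i = Fin.fromℕ<-injective _ _ _ _
      (funToFin-injective (coordinates c j) (coordinates c′ j′)
        (Fin.combine-injectiveˡ (funToFin (coordinates c j)) _ (funToFin (coordinates c′ j′)) _ values) i)

    vertex-norm : norm c (toℕ j) ≡ norm c′ (toℕ j′)
    vertex-norm = Fin.fromℕ<-injective _ _ _ _
      (Fin.combine-injectiveʳ (funToFin (coordinates c j)) (normValue c j)
        (funToFin (coordinates c′ j′)) (normValue c′ j′) values)

  -- In every coordinate a polynomial of degree at most `1 + k′` is determined by its values at
  -- `2 + k′` positions.
  sparse : ∀ c c′ (r : Fin (2 + k′) → Fin (suc t)) → Injective _≡_ _≡_ r →
    (∀ i → vertex c (r i) ≡ vertex c′ (r i)) → c ≡ c′
  sparse c c′ r r-inj agree = colour-≡ c c′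
    (λ i → Fin.toℕ-injective (proj₁ (coefficients i)))
    (λ l i → Fin.toℕ-injective (proj₂ (coefficients i) l))
    (λ l → Fin.toℕ-injective (proj₂ normCoefficients l))
    where
    coefficients : ∀ i → toℕ (lead c i) ≡ toℕ (lead c′ i) × (∀ l → toℕ (low c l i) ≡ toℕ (low c′ l i))
    coefficients i = evalℕ-injective _ _ _ _ (toℕ ∘ r) (r-inj ∘ Fin.toℕ-injective)
      (λ p → vertex-coordinate c c′ (r p) (r p) (agree p) i)
    normCoefficients : leadNorm c ≡ leadNorm c′ × (∀ l → toℕ (lowNorm c l) ≡ toℕ (lowNorm c′ l))
    normCoefficients = evalℕ-injective _ _ _ _ (toℕ ∘ r) (r-inj ∘ Fin.toℕ-injective)
      (λ p → vertex-norm c c′ (r p) (r p) (agree p))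

  -- The factors `u` and `v` depend only on the positions, so one affine relation holds in all `D`
  -- coordinates and in the norm coordinate, and strict convexity equates the leading coefficients
  -- of `c₀` and `c₂`.
  triangle : ∀ c₀ c₁ c₂ (r : Fin (3 + k′) → Fin (suc t)) → Injective _≡_ _≡_ r →
    (∀ i → i ≢ zero → i ≢ suc zero → vertex c₀ (r i) ≡ vertex c₁ (r i)) →
    (∀ i → i ≢ zero → i ≢ suc (suc zero) → vertex c₀ (r i) ≡ vertex c₂ (r i)) →
    vertex c₁ (r zero) ≡ vertex c₂ (r zero) → c₀ ≡ c₂
  triangle c₀ c₁ c₂ r r-inj agree₀₁ agree₀₂ agree₁₂ = colour-≡ c₀ c₂
    (λ i → Fin.toℕ-injective (lead≡ i))
    (λ l i → Fin.toℕ-injective (evalℕ-lower-injective (λ l → toℕ (low c₀ l i)) (λ l → toℕ (low c₂ l i)) (toℕ (lead c₀ i)) points points-injective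
      (λ p → trans (vertex-coordinate c₀ c₂ (r (skip p)) (r (skip p)) (meet p) i)
                   (cong (λ z → evalℕ (λ l → toℕ (low c₂ l i)) z (points p)) (sym (lead≡ i)))) l))
    (λ l → Fin.toℕ-injective (evalℕ-lower-injective (λ l → toℕ (lowNorm c₀ l)) (λ l → toℕ (lowNorm c₂ l)) (leadNorm c₀) points points-injective
      (λ p → trans (vertex-norm c₀ c₂ (r (skip p)) (r (skip p)) (meet p))
                   (cong (λ z → evalℕ (λ l → toℕ (lowNorm c₂ l)) z (points p)) (sym leadNorm≡))) l))
    where
    toℕ∘r-injective : Injective _≡_ _≡_ (toℕ ∘ r)
    toℕ∘r-injective = r-inj ∘ Fin.toℕ-injective
    u v : ℤ
    u = + toℕ (r zero) -ᶻ + toℕ (r (suc (suc zero)))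
    v = + toℕ (r zero) -ᶻ + toℕ (r (suc zero))
    r-distinct : ∀ {i j} → i ≢ j → + toℕ (r i) ≢ + toℕ (r j)
    r-distinct i≢j = i≢j ∘ toℕ∘r-injective ∘ ℤ.+-injective
    -- Here `u - v` is the difference of positions 1 and 2.
    u≢v : u ≢ v
    u≢v eq = r-distinct {suc (suc zero)} {suc zero} (λ ())
      (ℤ.neg-injective (+ᶻ-cancelˡ (+ toℕ (r zero)) _ _ eq))
    x : Colour → Fin D → ℤ
    x c i = + toℕ (lead c i)
    coordinate-relation : ∀ i → u *ᶻ (x c₀ i -ᶻ x c₁ i) ≡ v *ᶻ (x c₀ i -ᶻ x c₂ i)
    coordinate-relation i = leadℕ-relation (λ l → toℕ (low c₀ l i)) (λ l → toℕ (low c₁ l i)) (λ l → toℕ (low c₂ l i))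
      (toℕ (lead c₀ i)) (toℕ (lead c₁ i)) (toℕ (lead c₂ i)) (toℕ ∘ r) toℕ∘r-injective
      (λ p p≢0 p≢1 → vertex-coordinate c₀ c₁ (r p) (r p) (agree₀₁ p p≢0 p≢1) i)
      (λ p p≢0 p≢2 → vertex-coordinate c₀ c₂ (r p) (r p) (agree₀₂ p p≢0 p≢2) i)
      (vertex-coordinate c₁ c₂ (r zero) (r zero) agree₁₂ i)
    norm-relation : u *ᶻ (+ leadNorm c₀ -ᶻ + leadNorm c₁) ≡ v *ᶻ (+ leadNorm c₀ -ᶻ + leadNorm c₂)
    norm-relation = leadℕ-relation (λ l → toℕ (lowNorm c₀ l)) (λ l → toℕ (lowNorm c₁ l)) (λ l → toℕ (lowNorm c₂ l))
      (leadNorm c₀) (leadNorm c₁) (leadNorm c₂) (toℕ ∘ r) toℕ∘r-injective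
      (λ p p≢0 p≢1 → vertex-norm c₀ c₁ (r p) (r p) (agree₀₁ p p≢0 p≢1))
      (λ p p≢0 p≢2 → vertex-norm c₀ c₂ (r p) (r p) (agree₀₂ p p≢0 p≢2))
      (vertex-norm c₁ c₂ (r zero) (r zero) agree₁₂)
    N : Colour → ℤ
    N c = ∑ (λ i → x c i *ᶻ x c i)
    N≡ : ∀ c → + leadNorm c ≡ N c
    N≡ c = sym (∑-squares-pos (λ i → toℕ (lead c i)))
    N-relation : u *ᶻ (N c₀ -ᶻ N c₁) ≡ v *ᶻ (N c₀ -ᶻ N c₂)
    N-relation = subst₂ _≡_ (cong (u *ᶻ_) (cong₂ _-ᶻ_ (N≡ c₀) (N≡ c₁))) (cong (v *ᶻ_) (cong₂ _-ᶻ_ (N≡ c₀) (N≡ c₂)))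
      norm-relation
    lead≡ : ∀ i → toℕ (lead c₀ i) ≡ toℕ (lead c₂ i)
    lead≡ i = ℤ.+-injective (paraboloid-strictly-convex u v (x c₀) (x c₁) (x c₂)
      (-≢0 (r-distinct {zero} {suc zero} (λ ()))) u≢v coordinate-relation N-relation i)
    leadNorm≡ : leadNorm c₀ ≡ leadNorm c₂
    leadNorm≡ = ∑ℕ-cong {D} (λ i → cong (λ z → z * z) (lead≡ i))
    -- The `1 + k′` positions where `c₀` and `c₂` meet; they determine the lower coefficients once
    -- the leading ones agree.
    skip : Fin (1 + k′) → Fin (3 + k′)
    skip p = punchIn (suc (suc zero)) (suc p)
    points : Fin (1 + k′) → ℕ
    points p = toℕ (r (skip p))
    points-injective : Injective _≡_ _≡_ points
    points-injective eq = Fin.suc-injective (Fin.punchIn-injective (suc (suc zero)) _ _ (toℕ∘r-injective eq))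
    meet : ∀ p → vertex c₀ (r (skip p)) ≡ vertex c₂ (r (skip p))
    meet p = agree₀₂ (skip p) (λ ()) (Fin.punchInᵢ≢i _ (suc p))

  family : ∀ {n} → vertices ≤ n → TriangleFreeFamily k′ (suc t) colours n
  family vertices≤n = record
    { vertex   = λ c j → inject≤ (vertex c j) vertices≤n
    ; position = λ {c} {c′} {j} {j′} eq → vertex-position c c′ j j′ (back eq)
    ; sparse   = λ c c′ r r-inj agree → sparse c c′ r r-inj (back ∘ agree)
    ; triangle = λ c₀ c₁ c₂ r r-inj agree₀₁ agree₀₂ agree₁₂ → triangle c₀ c₁ c₂ r r-inj
        (λ i i≢0 i≢1 → back (agree₀₁ i i≢0 i≢1)) (λ i i≢0 i≢2 → back (agree₀₂ i i≢0 i≢2)) (back agree₁₂)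
    }
    where
    back : ∀ {a b : Fin vertices} → inject≤ a vertices≤n ≡ inject≤ b vertices≤n → a ≡ b
    back = Fin.inject≤-injective vertices≤n vertices≤n _ _

-- Asymptotics

^-distribʳ-* : ∀ m n o → (m * n) ^ o ≡ m ^ o * n ^ o
^-distribʳ-* m n zero    = refl
^-distribʳ-* m n (suc o) = trans (cong (m * n *_) (^-distribʳ-* m n o)) (identity m n (m ^ o) (n ^ o))
  where
  identity : ∀ m n p q → m * n * (p * q) ≡ m * p * (n * q)
  identity = ℕ.solve-∀

-- Selects for each `n` the largest construction that fits, by induction on `n`: the bracket either
-- persists or moves up by one.
bracket : (f : ℕ → ℕ) → (∀ d → f d < f (suc d)) → ∀ {d₀ n} → f d₀ ≤ n →
  ∃[ d ] d₀ ≤ d × f d ≤ n × n < f (suc d)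
bracket f f-mono {d₀} fd₀≤n = go (ℕ.≤⇒≤′ fd₀≤n)
  where
  go : ∀ {n} → f d₀ ℕ.≤′ n → ∃[ d ] d₀ ≤ d × f d ≤ n × n < f (suc d)
  go ℕ.≤′-refl = d₀ , ℕ.≤-refl , ℕ.≤-refl , f-mono d₀
  go {suc n} (ℕ.≤′-step le) with go le
  ... | d , d₀≤d , fd≤n , n<fd+1 with suc n ℕ.<? f (suc d)
  ...   | yes 1+n<fd+1 = d , d₀≤d , ℕ.m≤n⇒m≤1+n fd≤n , 1+n<fd+1
  -- In this case `suc n` equals `f (suc d)`.
  ...   | no  1+n≮fd+1 = suc d , ℕ.m≤n⇒m≤1+n d₀≤d , ℕ.≮⇒≥ 1+n≮fd+1 , ℕ.≤-<-trans n<fd+1 (f-mono (suc d))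

-- With D = 2s + 1 there are about n = d^(D+2) vertices and at least d^(k(D+2)-2) colours,
-- and (k(D+2)-2)(s+1) exceeds (D+2)(k(s+1)-1) by exactly 1: the spare factor d absorbs the constants.
module Size (k′ t s : ℕ) where

  open Construction k′ t (2 * s) using (colours; vertices)

  private
    D = 1 + 2 * s
    C = suc t ^ (1 + k′)
    e = 2 + D
    K₀ = (2 + k′) * suc s ∸ 1
    -- `vertices d` is `c₀ * d ^ e`; the factor `2 ^ e` pays for passing from `suc d` to `d`, and
    -- `d₀` is the total constant to be absorbed after raising to the power `K₀`.
    c₀ = suc t * (C ^ D * (C * D))
    c₁ = c₀ * 2 ^ e
    d₀ = c₁ ^ K₀

    instance
      C≢0 : ℕ.NonZero C
      C≢0 = ℕ.m^n≢0 (suc t) (1 + k′)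
      C^D≢0 : ℕ.NonZero (C ^ D)
      C^D≢0 = ℕ.m^n≢0 C D
      C*D≢0 : ℕ.NonZero (C * D)
      C*D≢0 = ℕ.m*n≢0 C D
      C^D*C*D≢0 : ℕ.NonZero (C ^ D * (C * D))
      C^D*C*D≢0 = ℕ.m*n≢0 (C ^ D) (C * D)
      c₀≢0 : ℕ.NonZero c₀
      c₀≢0 = ℕ.m*n≢0 (suc t) (C ^ D * (C * D))
      2^e≢0 : ℕ.NonZero (2 ^ e)
      2^e≢0 = ℕ.m^n≢0 2 e
      c₁≢0 : ℕ.NonZero c₁
      c₁≢0 = ℕ.m*n≢0 c₀ (2 ^ e)
      d₀≢0 : ℕ.NonZero d₀
      d₀≢0 = ℕ.m^n≢0 c₁ K₀

  vertices≡ : ∀ d → vertices d ≡ c₀ * d ^ e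
  vertices≡ d = trans (cong (λ z → suc t * (z * (C * (D * (d * d))))) (^-distribʳ-* C d D))
    (identity (suc t) (C ^ D) (d ^ D) C D d)
    where
    identity : ∀ t p q C D d → t * (p * q * (C * (D * (d * d)))) ≡ t * (p * (C * D)) * (d * (d * q))
    identity = ℕ.solve-∀

  vertices-< : ∀ d → vertices d < vertices (suc d)
  vertices-< d = subst₂ _<_ (sym (vertices≡ d)) (sym (vertices≡ (suc d)))
    (ℕ.*-monoʳ-< c₀ (ℕ.^-monoˡ-< e (ℕ.n<1+n d)))

  -- The exponent is `(2 + k′) * e - 2`: each lower coefficient contributes `e`, the leading one
  -- only `D = e - 2`.
  colours-≥ : ∀ d → d ^ (D + e * (1 + k′)) ≤ colours d
  colours-≥ d = begin
    d ^ (D + e * (1 + k′))                             ≡⟨ ℕ.^-distribˡ-+-* d D (e * (1 + k′)) ⟩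
    d ^ D * d ^ (e * (1 + k′))                         ≡⟨ cong (d ^ D *_) (ℕ.^-*-assoc d e (1 + k′)) ⟨
    d ^ D * (d ^ e) ^ (1 + k′)                         ≤⟨ ℕ.*-monoʳ-≤ (d ^ D) (ℕ.^-monoˡ-≤ (1 + k′) d^e≤) ⟩
    d ^ D * (d ^ D * (D * (d * d))) ^ (1 + k′)       ∎
    where
    open ℕ.≤-Reasoning
    identity : ∀ d q → d * (d * q) ≡ q * (d * d)
    identity = ℕ.solve-∀
    d^e≤ : d ^ e ≤ d ^ D * (D * (d * d))
    d^e≤ = begin
      d ^ e                       ≡⟨ identity d (d ^ D) ⟩
      d ^ D * (d * d)            ≤⟨ ℕ.*-monoʳ-≤ (d ^ D) (ℕ.m≤n*m (d * d) D) ⟩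
      d ^ D * (D * (d * d))     ∎

  colours-vs-vertices : ∀ {d n} → d₀ ≤ d → n < vertices (suc d) → n ^ K₀ ≤ colours d ^ suc s
  colours-vs-vertices {d} {n} d₀≤d n< = begin
    n ^ K₀                                  ≤⟨ ℕ.^-monoˡ-≤ K₀ n≤ ⟩
    (c₁ * d ^ e) ^ K₀                       ≡⟨ ^-distribʳ-* c₁ (d ^ e) K₀ ⟩
    d₀ * (d ^ e) ^ K₀                       ≤⟨ ℕ.*-monoˡ-≤ ((d ^ e) ^ K₀) d₀≤d ⟩
    d * (d ^ e) ^ K₀                        ≡⟨ cong (d *_) (ℕ.^-*-assoc d e K₀) ⟩
    d ^ (1 + e * K₀)                        ≡⟨ cong (d ^_) (exponents s k′) ⟩
    d ^ ((D + e * (1 + k′)) * suc s)       ≡⟨ ℕ.^-*-assoc d (D + e * (1 + k′)) (suc s) ⟨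
    (d ^ (D + e * (1 + k′))) ^ suc s       ≤⟨ ℕ.^-monoˡ-≤ (suc s) (colours-≥ d) ⟩
    colours d ^ suc s                       ∎
    where
    open ℕ.≤-Reasoning
    -- `K₀` unfolds to `s + (1 + k′) * suc s`, which removes the truncated subtraction. What
    -- remains, `1 + (D + 2) * s = D * suc s`, dictates `D = 1 + 2 * s`.
    exponents : ∀ s k′ → 1 + (3 + 2 * s) * (s + (1 + k′) * suc s) ≡ ((1 + 2 * s) + (3 + 2 * s) * (1 + k′)) * suc s
    exponents = ℕ.solve-∀
    1≤d : 1 ≤ d
    1≤d = ℕ.≤-trans (ℕ.>-nonZero⁻¹ d₀) d₀≤d
    1+d≤2d : suc d ≤ 2 * d
    1+d≤2d = ℕ.+-mono-≤ 1≤d (ℕ.m≤m+n d 0)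
    n≤ : n ≤ c₁ * d ^ e
    n≤ = begin
      n                        ≤⟨ ℕ.<⇒≤ n< ⟩
      vertices (suc d)         ≡⟨ vertices≡ (suc d) ⟩
      c₀ * suc d ^ e           ≤⟨ ℕ.*-monoʳ-≤ c₀ (ℕ.^-monoˡ-≤ e 1+d≤2d) ⟩
      c₀ * (2 * d) ^ e         ≡⟨ cong (c₀ *_) (^-distribʳ-* 2 d e) ⟩
      c₀ * (2 ^ e * d ^ e)     ≡⟨ ℕ.*-assoc c₀ (2 ^ e) (d ^ e) ⟨
      c₁ * d ^ e               ∎

  large-family : ∃[ N ] ∀ n → N ≤ n →
    ∃[ m ] TriangleFreeFamily k′ (suc t) m n × n ^ K₀ ≤ m ^ suc s
  large-family = vertices d₀ , λ n N≤n →
    let d , d₀≤d , fits , n< = bracket vertices vertices-< N≤n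
    in colours d , Construction.family k′ t (2 * s) d fits , colours-vs-vertices d₀≤d n<

large-triangleFree-family : ∀ k′ t s → 0 < t → ∃[ N ] ∀ n → N ≤ n →
  ∃[ m ] TriangleFreeFamily k′ t m n × n ^ ((2 + k′) * suc s ∸ 1) ≤ m ^ suc s
large-triangleFree-family k′ (suc t) s _ = Size.large-family k′ t s

-- Combining the two bounds

power-≤ : ∀ n k s → (n ^ suc k) ^ suc s ≤ n ^ (suc k * suc s + 1)
power-≤ zero      k s = z≤n
power-≤ n@(suc _) k s = begin
  (n ^ suc k) ^ suc s        ≡⟨ ℕ.^-*-assoc n (suc k) (suc s) ⟩
  n ^ (suc k * suc s)        ≤⟨ ℕ.^-monoʳ-≤ n (ℕ.m≤m+n (suc k * suc s) 1) ⟩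
  n ^ (suc k * suc s + 1)    ∎
  where open ℕ.≤-Reasoning

ex-of-H3-container : ∀ k′ (G F : Hypergraph) → Uniform (2 + k′) F → ∃ (Edge F) →
  ContainsCopy G (H3 k′) → ExIsNkMinusO1 (2 + k′) F G
ex-of-H3-container k′ G F F-uniform (f , f∈F) H3⊆G s =
  -- The vertices of `F` serve as positions; there is at least one because `f` is nonempty.
  let N , large = large-triangleFree-family k′ (V F) s (edge⇒vertex f (F-uniform f f∈F))
  in N , λ n N≤n →
    let m , family , n^≤ = large n N≤n
    in (m , (familyPacking F F-uniform family , family-noRainbow F F-uniform family G H3⊆G , ℕ.≤-refl) , n^≤)
     , (n ^ (2 + k′) , (λ P _ → subst (λ k → _ ≤ n ^ k) (F-uniform f f∈F) (packing-size P f f∈F)) , power-≤ n (1 + k′) s)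
  where
  edge⇒vertex : ∀ {v} (f : Subset v) → ∣ f ∣ ≡ 2 + k′ → 0 < v
  edge⇒vertex {zero}  [] ()
  edge⇒vertex {suc v} f  eq = z<s

H3-edge-of : ∀ {k′} H → ContainsCopy H (H3 k′) → ∃ (Edge H)
H3-edge-of H (ψ , _ , ψ-edge) = image ψ (∁ ⁅ zero ⁆) , ψ-edge _ (inj₁ refl)

theorem1p11 : ((k′ : ℕ) → (G F : Hypergraph) → Uniform (2 + k′) G → Uniform (2 + k′) F →
    ContainsCopy G (H3 k′) → Hom G F → ExIsNkMinusO1 (2 + k′) F G)
    × ((k t r : ℕ) → 2 ≤ k → k < r → r ≤ t → ExIsNkMinusO1 k (K k t) (K k r))
theorem1p11 = general , complete
  where
  general : (k′ : ℕ) → (G F : Hypergraph) → Uniform (2 + k′) G → Uniform (2 + k′) F →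
    ContainsCopy G (H3 k′) → Hom G F → ExIsNkMinusO1 (2 + k′) F G
  general k′ G F _ F-uniform H3⊆G (φ , φ-edge) =
    -- The homomorphism carries an edge of the tight triangle in `G` to an edge of `F`.
    let e , e∈G = H3-edge-of G H3⊆G
    in ex-of-H3-container k′ G F F-uniform (image φ e , φ-edge e e∈G) H3⊆G

  complete : (k t r : ℕ) → 2 ≤ k → k < r → r ≤ t → ExIsNkMinusO1 k (K k t) (K k r)
  complete (suc (suc k′)) t r (s≤s (s≤s z≤n)) k<r r≤t =
    ex-of-H3-container k′ (K (2 + k′) r) (K (2 + k′) t) (λ _ ∣e∣≡k → ∣e∣≡k)
      -- Since `k < r ≤ t`, `K k t` also contains a tight triangle, which supplies an edge.
      (H3-edge-of (K (2 + k′) t) (K-contains-H3 k′ t (ℕ.≤-trans k<r r≤t))) (K-contains-H3 k′ r k<r)
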